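{- In propositional Classical Linear Logic with the additional rules Mix and BiCut, the exponentials and the (weak) coexponentials coincide up to provability, in the following sense. (1) Consider the system consisting of the exponential-free rules of Classical Linear Logic, the rules Mix and BiCut, and the coexponential rules $(\mathsf{Q}w)$, $(\mathsf{Q}d)$, $(\mathsf{Q}c)$, $(\mathsf{E})$. If in each of the exponential rules $(?w)$, $(?d)$, $(?c)$, $(!)$ one replaces every $?$ by $\mathsf{Q}$ and every $!$ by $\mathsf{E}$, then the resulting rule is derivable in this system (its conclusion can be derived from its premises). (2) Conversely, consider the system consisting of the exponential-free rules of Classical Linear Logic, the rules Mix and BiCut, and the exponential rules $(?w)$, $(?d)$, $(?c)$, $(!)$. If in each of the coexponential rules $(\mathsf{Q}w)$, $(\mathsf{Q}d)$, $(\mathsf{Q}c)$, $(\mathsf{E})$ one replaces every $\mathsf{Q}$ by $?$ and every $\mathsf{E}$ by $!$, then the resulting rule is derivable in this system.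
   Context: Formulas are built from atoms and their duals by the multiplicatives $\otimes$ (tensor, unit $\mathbf 1$) and $\wp$ (par, unit $\bot$), the additives $\oplus$ (unit $\mathbf 0$) and $\&$ (unit $\top$), and, depending on the system, either the exponentials $!,?$ or the coexponentials $\mathsf E,\mathsf Q$. Linear negation $A^\perp$ is the involution defined by De Morgan duality: $(A\otimes B)^\perp = A^\perp\wp B^\perp$, $\mathbf 1^\perp=\bot$, $(A\oplus B)^\perp=A^\perp\& B^\perp$, $\mathbf 0^\perp=\top$, $(!A)^\perp = {?}A^\perp$, $(\mathsf Q A)^\perp=\mathsf E A^\perp$, and vice versa. Sequents are one-sided, $\vdash\Gamma$, with $\Gamma$ a finite multiset of formulas (possibly empty). The exponential-free rules of Classical Linear Logic are the usual ones: axiom $\vdash A^\perp,A$ (for every formula $A$ of the system); Cut (from $\vdash\Gamma,A$ and $\vdash\Delta,A^\perp$ infer $\vdash\Gamma,\Delta$); $\otimes$ (from $\vdash\Gamma,A$ and $\vdash\Delta,B$ infer $\vdash\Gamma,\Delta,A\otimes B$); $\wp$ (from $\vdash\Gamma,A,B$ infer $\vdash\Gamma,A\wp B$); $\vdash\mathbf 1$; from $\vdash\Gamma$ infer $\vdash\Gamma,\bot$; from $\vdash\Gamma,A$ infer $\vdash\Gamma,A\oplus B$ and $\vdash\Gamma,B\oplus A$; from $\vdash\Gamma,A$ and $\vdash\Gamma,B$ infer $\vdash\Gamma,A\& B$; $\vdash\Gamma,\top$. Additional rules: Mix: from $\vdash\Gamma$ and $\vdash\Delta$ infer $\vdash\Gamma,\Delta$.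 BiCut: from $\vdash\Gamma,A,B$ and $\vdash\Delta,A^\perp,B^\perp$ infer $\vdash\Gamma,\Delta$. Exponential rules: $(?w)$ from $\vdash\Gamma$ infer $\vdash\Gamma,?A$; $(?d)$ from $\vdash\Gamma,A$ infer $\vdash\Gamma,?A$; $(?c)$ from $\vdash\Gamma,?A,?A$ infer $\vdash\Gamma,?A$; $(!)$ from $\vdash{?}\Gamma,A$ infer $\vdash{?}\Gamma,!A$, where ${?}\Gamma$ is obtained by applying $?$ to every formula of $\Gamma$. (Weak) coexponential rules: $(\mathsf Qw)$ $\vdash\mathsf QA$, with no premises and no side formulas; $(\mathsf Qd)$ from $\vdash\Gamma,A$ infer $\vdash\Gamma,\mathsf QA$; $(\mathsf Qc)$ from $\vdash\Gamma,\mathsf QA$ and $\vdash\Delta,\mathsf QA$ infer $\vdash\Gamma,\Delta,\mathsf QA$; $(\mathsf E)$ from $\vdash\bigotimes\mathsf Q\Gamma,\,A$ infer $\vdash\bigotimes\mathsf Q\Gamma,\,\mathsf EA$, where $\mathsf Q\Gamma$ is obtained by applying $\mathsf Q$ to every formula of $\Gamma$, and $\bigotimes$ folds the resulting list into the single formula that is its tensor product (with $\bigotimes$ of the empty list being $\mathbf 1$). -}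

module Defs where

open import Data.List.Base using (List; []; _∷_; _++_; [_]; map; foldr)
open import Data.List.Membership.Propositional using (_∈_)
open import Data.List.Relation.Binary.Permutation.Propositional using (_↭_)
open import Data.List.Relation.Unary.All using (All)
open import Level using (Level; suc)
open import Relation.Binary.Construct.Union using (_∪_)
open import Relation.Binary.Core using (REL)

private
  variable
    a : Level

data Modality : Set where
  exponential coexponential : Modality

infix  9 _^⊥
infix  8 !_ ⁇_
infixr 7 _⊗_ _⅋_
infixr 6 _⊕_ _&_

-- The index keeps the two languages apart: a formula contains only
-- exponentials or only coexponentials.  (`?` is reserved in Agda, hence `⁇_`.)
data Formula (Atom : Set a) : Modality → Set a where
  atom atom^⊥     : ∀ {m} → Atom → Formula Atom m
  _⊗_ _⅋_ _⊕_ _&_ : ∀ {m} → Formula Atom m → Formula Atom m → Formula Atom m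
  𝟏 ⊥ 𝟎 ⊤         : ∀ {m} → Formula Atom m
  !_ ⁇_           : Formula Atom exponential → Formula Atom exponential
  E Q             : Formula Atom coexponential → Formula Atom coexponential

_^⊥ : {Atom : Set a} {m : Modality} → Formula Atom m → Formula Atom m
atom x   ^⊥ = atom^⊥ x
atom^⊥ x ^⊥ = atom x
(A ⊗ B)  ^⊥ = A ^⊥ ⅋ B ^⊥
(A ⅋ B)  ^⊥ = A ^⊥ ⊗ B ^⊥
(A ⊕ B)  ^⊥ = A ^⊥ & B ^⊥
(A & B)  ^⊥ = A ^⊥ ⊕ B ^⊥
𝟏        ^⊥ = ⊥
⊥        ^⊥ = 𝟏
𝟎        ^⊥ = ⊤
⊤        ^⊥ = 𝟎
(! A)    ^⊥ = ⁇ (A ^⊥)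
(⁇ A)    ^⊥ = ! (A ^⊥)
(E A)    ^⊥ = Q (A ^⊥)
(Q A)    ^⊥ = E (A ^⊥)

⨂ : {Atom : Set a} {m : Modality} → List (Formula Atom m) → Formula Atom m
⨂ = foldr _⊗_ 𝟏

-- Multisets are represented by lists; `exchange` in `Derivation` below
-- identifies lists up to permutation.
Sequent : Set a → Modality → Set a
Sequent Atom m = List (Formula Atom m)

-- A rule relates the list of premises of each of its instances to the
-- conclusion.
Rules : Set a → Modality → Set (suc a)
Rules {a} Atom m = REL (List (Sequent Atom m)) (Sequent Atom m) a

module _ {Atom : Set a} {m : Modality} where

  data CLLRule : Rules Atom m where
    ax  : ∀ {A}         → CLLRule [] (A ^⊥ ∷ A ∷ [])
    cut : ∀ {Γ Δ A}     → CLLRule ((A ∷ Γ) ∷ (A ^⊥ ∷ Δ) ∷ []) (Γ ++ Δ)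
    ⊗-r : ∀ {Γ Δ A B}   → CLLRule ((A ∷ Γ) ∷ (B ∷ Δ) ∷ []) (A ⊗ B ∷ Γ ++ Δ)
    ⅋-r : ∀ {Γ A B}     → CLLRule [ A ∷ B ∷ Γ ] (A ⅋ B ∷ Γ)
    𝟏-r :                 CLLRule [] [ 𝟏 ]
    ⊥-r : ∀ {Γ}         → CLLRule [ Γ ] (⊥ ∷ Γ)
    ⊕₁  : ∀ {Γ A B}     → CLLRule [ A ∷ Γ ] (A ⊕ B ∷ Γ)
    ⊕₂  : ∀ {Γ A B}     → CLLRule [ A ∷ Γ ] (B ⊕ A ∷ Γ)
    &-r : ∀ {Γ A B}     → CLLRule ((A ∷ Γ) ∷ (B ∷ Γ) ∷ []) (A & B ∷ Γ)
    ⊤-r : ∀ {Γ}         → CLLRule [] (⊤ ∷ Γ)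

  data MixRule : Rules Atom m where
    mix : ∀ {Γ Δ} → MixRule (Γ ∷ Δ ∷ []) (Γ ++ Δ)

  data BiCutRule : Rules Atom m where
    bicut : ∀ {Γ Δ A B} →
            BiCutRule ((A ∷ B ∷ Γ) ∷ (A ^⊥ ∷ B ^⊥ ∷ Δ) ∷ []) (Γ ++ Δ)

  -- The modal rules are schematic in the pair of dual modalities, so that
  -- replacing one pair by the other is a change of arguments.

  data ExponentialRule (⟨?⟩ ⟨!⟩ : Formula Atom m → Formula Atom m) :
       Rules Atom m where
    ?w : ∀ {Γ A} → ExponentialRule ⟨?⟩ ⟨!⟩ [ Γ ] (⟨?⟩ A ∷ Γ)
    ?d : ∀ {Γ A} → ExponentialRule ⟨?⟩ ⟨!⟩ [ A ∷ Γ ] (⟨?⟩ A ∷ Γ)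
    ?c : ∀ {Γ A} → ExponentialRule ⟨?⟩ ⟨!⟩ [ ⟨?⟩ A ∷ ⟨?⟩ A ∷ Γ ] (⟨?⟩ A ∷ Γ)
    !p : ∀ {Γ A} → ExponentialRule ⟨?⟩ ⟨!⟩ [ A ∷ map ⟨?⟩ Γ ] (⟨!⟩ A ∷ map ⟨?⟩ Γ)

  data CoexponentialRule (⟨Q⟩ ⟨E⟩ : Formula Atom m → Formula Atom m) :
       Rules Atom m where
    Qw : ∀ {A}     → CoexponentialRule ⟨Q⟩ ⟨E⟩ [] [ ⟨Q⟩ A ]
    Qd : ∀ {Γ A}   → CoexponentialRule ⟨Q⟩ ⟨E⟩ [ A ∷ Γ ] (⟨Q⟩ A ∷ Γ)
    Qc : ∀ {Γ Δ A} → CoexponentialRule ⟨Q⟩ ⟨E⟩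
                       ((⟨Q⟩ A ∷ Γ) ∷ (⟨Q⟩ A ∷ Δ) ∷ []) (⟨Q⟩ A ∷ Γ ++ Δ)
    Ep : ∀ {Γ A}   → CoexponentialRule ⟨Q⟩ ⟨E⟩
                       [ A ∷ ⨂ (map ⟨Q⟩ Γ) ∷ [] ] (⟨E⟩ A ∷ ⨂ (map ⟨Q⟩ Γ) ∷ [])

  data Derivation (R : Rules Atom m) (Hs : List (Sequent Atom m)) :
       Sequent Atom m → Set a where
    hyp      : ∀ {Γ} → Γ ∈ Hs → Derivation R Hs Γ
    exchange : ∀ {Γ Δ} → Γ ↭ Δ → Derivation R Hs Γ → Derivation R Hs Δ
    rule     : ∀ {Ps Γ} → R Ps Γ → All (Derivation R Hs) Ps → Derivation R Hs Γ

  infix 4 _DerivableIn_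

  _DerivableIn_ : Rules Atom m → Rules Atom m → Set a
  S DerivableIn R = ∀ {Ps Γ} → S Ps Γ → Derivation R Ps Γ

module _ (Atom : Set a) where

  CoexponentialSystem : Rules Atom coexponential
  CoexponentialSystem = CLLRule ∪ MixRule ∪ BiCutRule ∪ CoexponentialRule Q E

  ExponentialSystem : Rules Atom exponential
  ExponentialSystem = CLLRule ∪ MixRule ∪ BiCutRule ∪ ExponentialRule ⁇_ !_

-- BiCut turns ⊢ Γ, A, B into ⊢ Γ, A ⊗ B and proves the empty sequent; Mix
-- gives the converse of the former and turns ⊢ Γ into ⊢ Γ, 𝟏.  So a context Γ
-- may be traded for the single formula ⨂ Γ and back, which identifies the two
-- promotion rules; the structural rules differ only by Mix and BiCut.
module Submission where

open import Defs
open import Data.List.Base using (List; []; _∷_; _++_; [_]; map)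
open import Data.List.Relation.Binary.Permutation.Propositional
  using (↭-sym; swap; prep; refl; trans)
open import Data.List.Relation.Binary.Permutation.Propositional.Properties
  using (shift; ++-comm)
open import Data.List.Relation.Unary.All using (All; []; _∷_)
open import Data.List.Relation.Unary.Any using (here; there)
open import Data.Product using (_×_; _,_)
open import Data.Sum.Base using (inj₁; inj₂)
open import Level using (Level)
open import Relation.Binary.Construct.Union using (_∪_)
open import Relation.Binary.PropositionalEquality using (refl)

-- The lemmas below use no modal rule, so `M` stays arbitrary and both systems share them.
module MixBiCut {a : Level} {Atom : Set a} {m : Modality}
                (M : Rules Atom m) (Hs : List (Sequent Atom m)) where

  infix 3 ⊢_

  ⊢_ : Sequent Atom m → Set a
  ⊢_ = Derivation (CLLRule ∪ MixRule ∪ BiCutRule ∪ M) Hs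

  cll : ∀ {Ps Γ} → CLLRule Ps Γ → All ⊢_ Ps → ⊢ Γ
  cll r = rule (inj₁ r)

  modal : ∀ {Ps Γ} → M Ps Γ → All ⊢_ Ps → ⊢ Γ
  modal r = rule (inj₂ (inj₂ (inj₂ r)))

  ⊢mix : ∀ {Γ Δ} → ⊢ Γ → ⊢ Δ → ⊢ Γ ++ Δ
  ⊢mix d e = rule (inj₂ (inj₁ mix)) (d ∷ e ∷ [])

  ⊢bicut : ∀ {Γ Δ A B} → ⊢ A ∷ B ∷ Γ → ⊢ A ^⊥ ∷ B ^⊥ ∷ Δ → ⊢ Γ ++ Δ
  ⊢bicut d e = rule (inj₂ (inj₂ (inj₁ bicut))) (d ∷ e ∷ [])

  ⊢ax : ∀ A → ⊢ A ∷ A ^⊥ ∷ []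
  ⊢ax A = exchange (swap _ _ refl) (cll ax [])

  -- The axioms for `𝟏` and for `⊥` list pairwise dual formulas, so one BiCut consumes both
  -- entirely.
  ⊢[] : ⊢ []
  ⊢[] = ⊢bicut {A = 𝟏} {B = ⊥} (⊢ax 𝟏) (⊢ax ⊥)

  -- Tensoring the axioms for `A` and `B` leaves both duals side by side in one sequent, as BiCut
  -- requires.
  ⅋⇒⊗ : ∀ {Γ A B} → ⊢ A ∷ B ∷ Γ → ⊢ A ⊗ B ∷ Γ
  ⅋⇒⊗ {Γ} {A} {B} d = exchange (++-comm Γ _)
    (⊢bicut d
      (exchange (trans (swap _ _ refl) (prep _ (swap _ _ refl)))
        (cll ⊗-r (⊢ax A ∷ ⊢ax B ∷ []))))

  ⨂-intro : ∀ Γ {Δ} → ⊢ Γ ++ Δ → ⊢ ⨂ Γ ∷ Δ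
  ⨂-intro []      d = ⊢mix (cll 𝟏-r []) d
  ⨂-intro (A ∷ Γ) {Δ} d =
    -- `A` is parked in the side context, over which the induction is general, while `Γ` is folded.
    ⅋⇒⊗ (exchange (swap _ _ refl)
      (⨂-intro Γ (exchange (↭-sym (shift A Γ Δ)) d)))

  -- The dual of `⨂ Γ` is an iterated par ending in `⊥`: Mix collects the axioms of the members, and
  -- `⊥` is introduced over the empty sequent.
  ⨂-ax : ∀ Γ → ⊢ ⨂ Γ ^⊥ ∷ Γ
  ⨂-ax []      = cll ⊥-r (⊢[] ∷ [])
  ⨂-ax (A ∷ Γ) =
    cll ⅋-r (exchange (prep _ (swap _ _ refl))
      (⊢mix (cll ax []) (⨂-ax Γ)) ∷ [])

  ⨂-elim : ∀ Γ {Δ} → ⊢ ⨂ Γ ∷ Δ → ⊢ Δ ++ Γ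
  ⨂-elim Γ d = cll cut (d ∷ ⨂-ax Γ ∷ [])

exponential-in-coexponential : ∀ {a} (Atom : Set a) →
  ExponentialRule Q E DerivableIn CoexponentialSystem Atom
exponential-in-coexponential Atom = derive
  where
  open MixBiCut {Atom = Atom} (CoexponentialRule Q E)

  derive : ∀ {Ps Γ} → ExponentialRule Q E Ps Γ → ⊢_ Ps Γ
  derive ?w = ⊢mix _ (modal _ Qw []) (hyp (here refl))
  derive ?d = modal _ Qd (hyp (here refl) ∷ [])
  -- `Qc` wants its two copies in separate premises. Applied to two axioms, it gives a sequent whose
  -- two `Q A ^⊥` are cut at once against the copies in the hypothesis.
  derive (?c {Γ} {A}) = exchange (++-comm Γ [ Q A ])
    (⊢bicut _ (hyp (here refl))
      (exchange (trans (swap _ _ refl) (prep _ (swap _ _ refl)))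
        (modal _ Qc (⊢ax _ (Q A) ∷ ⊢ax _ (Q A) ∷ []))))
  derive (!p {Γ} {A}) = ⨂-elim _ (map Q Γ)
    (exchange (swap _ _ refl)
      (modal _ (Ep {Γ = Γ})
        (exchange (swap _ _ refl)
          (⨂-intro _ (map Q Γ)
            (exchange (++-comm [ A ] (map Q Γ)) (hyp (here refl)))) ∷ [])))

coexponential-in-exponential : ∀ {a} (Atom : Set a) →
  CoexponentialRule ⁇_ !_ DerivableIn ExponentialSystem Atom
coexponential-in-exponential Atom = derive
  where
  open MixBiCut {Atom = Atom} (ExponentialRule ⁇_ !_)

  derive : ∀ {Ps Γ} → CoexponentialRule ⁇_ !_ Ps Γ → ⊢_ Ps Γ
  -- Weakening needs a premise; the empty sequent adds no side formulas.
  derive Qw = modal _ ?w (⊢[] _ ∷ [])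
  derive Qd = modal _ ?d (hyp (here refl) ∷ [])
  derive (Qc {Γ} {Δ} {A}) = modal _ ?c
    (exchange (prep _ (shift (⁇ A) Γ Δ))
      (⊢mix _ (hyp (here refl)) (hyp (there (here refl)))) ∷ [])
  -- Opposite order to `!p` above: unfold the tensor, promote, refold.
  derive (Ep {Γ} {A}) = exchange (swap _ _ refl)
    (⨂-intro _ (map ⁇_ Γ)
      (exchange (++-comm [ ! A ] (map ⁇_ Γ))
        (modal _ (!p {Γ = Γ})
          (⨂-elim _ (map ⁇_ Γ)
            (exchange (swap _ _ refl) (hyp (here refl))) ∷ []))))

theorem1 : ∀ {a : Level} (Atom : Set a) →
    (ExponentialRule Q E DerivableIn CoexponentialSystem Atom)
    × (CoexponentialRule ⁇_ !_ DerivableIn ExponentialSystem Atom)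
theorem1 Atom = exponential-in-coexponential Atom , coexponential-in-exponential Atom
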